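{- Let $C$ be an extended linear code of length $5$ over $\mathbb{Z}_N$ and let $g=(g_{ji})$ be an $m\times5$ matrix that generates $C$, with columns indexed by $i=0,\dots,4$, such that the greatest common divisor of $N$ and all the entries of $g$ is $1$. Put $\gcd_i=\gcd(g_{1i},\dots,g_{mi},N)$. If $C$ is thin, then at least one of the $\gcd_i$ is $N/\alpha$ with $\alpha\in\{2,3,4\}$.
   Context: $\mathbb{Z}_N=\mathbb{Z}/N\mathbb{Z}$; its elements are identified with the representatives $0,1,\dots,N-1$, and gcd's are taken of these integers. A linear code of length $n$ over $\mathbb{Z}_N$ is a submodule $C\subseteq\mathbb{Z}_N^n$; its elements are called words; a matrix generates $C$ if its rows generate $C$. $C$ is extended if every word has coordinate sum $0\bmod N$. An extended code is thin if it contains no word all of whose entries are nonzero.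
   Formalization: The formal statement additionally assumes that no column of g is identically zero (no gcd_i equals N); without this the claim fails, e.g. for N = 5 and g = (0 1 1 1 2), where C is thin but the gcd_i are 5,1,1,1,1. -}

module Defs where

open import Level using (Level; _⊔_; suc)
open import Data.Nat as ℕ using (ℕ; NonZero)
open import Data.Nat.DivMod using (_mod_)
open import Data.Nat.GCD using (gcd)
open import Data.Fin using (Fin; toℕ)
open import Data.Vec using (Vec; map; zipWith; replicate; lookup; foldr′; concat)
open import Data.Vec.Relation.Unary.All using (All)
open import Data.Product using (_×_; ∃-syntax)
open import Function.Bundles using (_⇔_)
open import Relation.Nullary using (¬_)
open import Relation.Unary using (Pred; _∈_)
open import Relation.Binary.PropositionalEquality using (_≡_; _≢_)

-- ℤ/Nℤ, each class being represented by its representative in 0, …, N − 1.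
ℤmod : ℕ → Set
ℤmod N = Fin N

module _ {N : ℕ} .{{_ : NonZero N}} where

  infixl 6 _+ₘ_ _+ᵥ_
  infixl 7 _*ₘ_ _*ᵥ_

  0ₘ : ℤmod N
  0ₘ = 0 mod N

  _+ₘ_ : ℤmod N → ℤmod N → ℤmod N
  x +ₘ y = (toℕ x ℕ.+ toℕ y) mod N

  _*ₘ_ : ℤmod N → ℤmod N → ℤmod N
  x *ₘ y = (toℕ x ℕ.* toℕ y) mod N

  0ᵥ : ∀ {n} → Vec (ℤmod N) n
  0ᵥ = replicate _ 0ₘ

  _+ᵥ_ : ∀ {n} → Vec (ℤmod N) n → Vec (ℤmod N) n → Vec (ℤmod N) n
  _+ᵥ_ = zipWith _+ₘ_

  _*ᵥ_ : ∀ {n} → ℤmod N → Vec (ℤmod N) n → Vec (ℤmod N) n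
  a *ᵥ v = map (a *ₘ_) v

  coordinateSum : ∀ {n} → Vec (ℤmod N) n → ℤmod N
  coordinateSum = foldr′ _+ₘ_ 0ₘ

record LinearCode (N : ℕ) .{{_ : NonZero N}} (n : ℕ) (ℓ : Level) : Set (suc ℓ) where
  field
    Word      : Pred (Vec (ℤmod N) n) ℓ
    0-closed  : 0ᵥ ∈ Word
    +-closed  : ∀ {v w} → v ∈ Word → w ∈ Word → (v +ᵥ w) ∈ Word
    *-closed  : ∀ a {v} → v ∈ Word → (a *ᵥ v) ∈ Word

open LinearCode public using (Word)

-- A matrix is the vector of its rows.
Matrix : ℕ → ℕ → ℕ → Set
Matrix N m n = Vec (Vec (ℤmod N) n) m

column : ∀ {N m n} → Matrix N m n → Fin n → Vec (ℤmod N) m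
column g i = map (λ row → lookup row i) g

-- gcd(x₁, …, xₖ, N), computed in ℕ on representatives; it equals N when all
-- the xⱼ vanish.
gcdWithModulus : ∀ {N k} → Vec (ℤmod N) k → ℕ
gcdWithModulus {N} = foldr′ (λ x d → gcd (toℕ x) d) N

columnGcd : ∀ {N m n} → Matrix N m n → Fin n → ℕ
columnGcd g i = gcdWithModulus (column g i)

entriesGcd : ∀ {N m n} → Matrix N m n → ℕ
entriesGcd g = gcdWithModulus (concat g)

module _ {N : ℕ} .{{_ : NonZero N}} where

  linearCombination : ∀ {m n} → Vec (ℤmod N) m → Matrix N m n → Vec (ℤmod N) n
  linearCombination c g = foldr′ _+ᵥ_ 0ᵥ (zipWith _*ᵥ_ c g)

  Generates : ∀ {m n ℓ} → Matrix N m n → LinearCode N n ℓ → Set ℓ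
  Generates g C = ∀ w → w ∈ Word C ⇔ (∃[ c ] w ≡ linearCombination c g)

  Extended : ∀ {n ℓ} → LinearCode N n ℓ → Set ℓ
  Extended C = ∀ w → w ∈ Word C → coordinateSum w ≡ 0ₘ

  -- Only meant for extended codes. A code with an identically zero coordinate
  -- is thin for trivial reasons.
  Thin : ∀ {n ℓ} → LinearCode N n ℓ → Set ℓ
  Thin C = ¬ (∃[ w ] w ∈ Word C × All (_≢ 0ₘ) w)

  NoZeroColumn : ∀ {m n} → Matrix N m n → Set
  NoZeroColumn g = ∀ i → ∃[ j ] lookup (lookup g j) i ≢ 0ₘ

{-# OPTIONS --safe #-}

-- For a coefficient vector c in ℤ_N^m, the i-th entry of the word c g vanishes
-- on a subgroup Kᵢ of index N / gcdᵢ. If all five indices were at least 5, the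
-- Kᵢ would have at most N^m elements in total counted with multiplicity; but
-- c = 0 lies in every Kᵢ, so they could not cover ℤ_N^m, and any c outside their
-- union gives a word without zero entries. The bound 5 |Kᵢ| ≤ N^m is
-- obtained by choosing t with (t g)ᵢ = gcdᵢ (Bézout) and noting that the translates
-- Kᵢ − k t for k < 5 are pairwise disjoint.
module Submission where

open import Defs
open import Level using (Level)
open import Data.Nat using (ℕ; NonZero; _*_)
open import Data.Product using (_×_; ∃-syntax)
open import Data.Sum using (_⊎_)
open import Relation.Binary.PropositionalEquality using (_≡_)

open import Data.Fin using (Fin; zero; suc; toℕ; combine; finToFun; funToFin)
open import Data.Fin.Permutation using (Permutation′; permutation; _⟨$⟩ʳ_)
open import Data.Fin.Properties
  using (toℕ<n; toℕ-injective; toℕ-fromℕ<; finToFun-funToFin; funToFin-finToFin; ¬∀⟶∃¬;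
         suc-injective; 0≢1+n)
open import Data.Nat
  using (zero; suc; _+_; _^_; _∸_; _≤_; _<_; z≤n; s≤s; pred; _≤?_; _≟_; ≢-nonZero; ≢-nonZero⁻¹;
         >-nonZero)
open import Data.Nat.DivMod
  using (_%_; _mod_; m%n<n; m%n%n≡m%n; m*n%n≡0; m<n⇒m%n≡m; [m+kn]%n≡m%n; %-distribˡ-+;
         %-distribˡ-*; n%n≡0)
open import Data.Nat.Divisibility
  using (_∣_; divides; ∣-refl; ∣-trans; ∣m+n∣m⇒∣n; >⇒∤; 0∣⇒≡0; m%n≡0⇒n∣m; n∣m⇒m%n≡0)
open import Data.Nat.GCD using (gcd; gcd[m,n]∣m; gcd[m,n]∣n; gcd-GCD; module Bézout)
open import Data.Nat.Properties
  using (+-0-commutativeMonoid; +-mono-≤; +-mono-<-≤; +-mono-≤-<; *-comm; *-cancelˡ-<; *-zeroʳ; *-identityʳ;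
         ≤-refl; ≤-trans; <-irrefl; <-≤-trans; ≤-<-trans; <⇒≤; ≰⇒>; <-cmp; m≤m+n; m≤n+m; m∸n≤m;
         m+[n∸m]≡n; m<n⇒0<n∸m; *-monoˡ-<; suc-pred; module ≤-Reasoning)
open import Data.Nat.Tactic.RingSolver using (solve-∀)
open import Data.Product using (_,_; proj₁; proj₂)
open import Data.Sum using (inj₁; inj₂)
open import Data.Vec using (Vec; []; _∷_; lookup; tabulate)
open import Data.Vec.Properties
  using (lookup-map; lookup-zipWith; lookup-replicate; lookup∘tabulate)
open import Data.Vec.Relation.Unary.All.Properties using (lookup⁻)
open import Function using (_∘_; const; case_of_)
open import Function.Bundles using (module Equivalence)
open import Relation.Binary.Definitions using (tri<; tri≈; tri>)
open import Relation.Binary.PropositionalEquality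
  using (_≢_; _≗_; refl; sym; trans; cong; cong₂; subst)
open import Relation.Nullary using (¬_; Dec; yes; no; contradiction)

open import Algebra.Properties.CommutativeMonoid.Sum +-0-commutativeMonoid
  using (sum; sum-cong-≗; ∑-comm; sum-permute)

-- Finite sums and double counting.

sum-mono-≤ : ∀ {n} {f g : Fin n → ℕ} → (∀ i → f i ≤ g i) → sum f ≤ sum g
sum-mono-≤ {zero}  f≤g = z≤n
sum-mono-≤ {suc n} f≤g = +-mono-≤ (f≤g zero) (sum-mono-≤ (f≤g ∘ suc))

sum-mono-< : ∀ {n} {f g : Fin n → ℕ} → (∀ i → f i ≤ g i) → ∀ i → f i < g i → sum f < sum g
sum-mono-< f≤g zero    f<g = +-mono-<-≤ f<g (sum-mono-≤ (f≤g ∘ suc))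
sum-mono-< f≤g (suc i) f<g = +-mono-≤-< (f≤g zero) (sum-mono-< (f≤g ∘ suc) i f<g)

term≤sum : ∀ {n} (f : Fin n → ℕ) i → f i ≤ sum f
term≤sum f zero    = m≤m+n (f zero) _
term≤sum f (suc i) = ≤-trans (term≤sum (f ∘ suc) i) (m≤n+m _ (f zero))

sum-zero : ∀ {n} {f : Fin n → ℕ} → (∀ i → f i ≡ 0) → sum f ≡ 0
sum-zero {zero}  f≡0 = refl
sum-zero {suc n} f≡0 = cong₂ _+_ (f≡0 zero) (sum-zero (f≡0 ∘ suc))

-- Z i is the indicator function of the i-th covering set; the hypothesis on π says
-- that the n + 1 translates of each of these sets are pairwise disjoint.
¬cover : ∀ {n M} (Z : Fin (suc n) → Fin M → ℕ) (π : Fin (suc n) → Fin (suc n) → Permutation′ M) →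
         (∀ i c → sum (λ k → Z i (π i k ⟨$⟩ʳ c)) ≤ 1) →
         (∀ c → 1 ≤ sum (λ i → Z i c)) →
         ∀ c → ¬ (1 < sum (λ i → Z i c))
-- A cover with one doubly covered point has total multiplicity above M, so n + 1 copies of it
-- exceed (n + 1)M; disjointness of the translates bounds the same number by (n + 1)M.
¬cover {n} {M} Z π disjoint cover c doublyCovered = <-irrefl refl (begin-strict
    sum {suc n} (λ k → sum {M} (const 1))
      <⟨ sum-mono-< {suc n} {λ _ → sum {M} (const 1)} (λ _ → <⇒≤ total) zero total ⟩
    sum {suc n} (λ k → sum (λ c → sum (λ i → Z i c)))
      ≡⟨ sum-cong-≗ {suc n} (λ k → ∑-comm (λ c i → Z i c)) ⟩
    sum {suc n} (λ k → sum (λ i → sum (Z i)))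
      ≡⟨ ∑-comm {suc n} (λ k i → sum (Z i)) ⟩
    sum (λ i → sum {suc n} (λ k → sum (Z i)))
      -- The n + 1 equal copies of the size of the i-th set are counted along its n + 1 different
      -- translates.
      ≡⟨ sum-cong-≗ (λ i → sum-cong-≗ (λ k → sum-permute (Z i) (π i k))) ⟩
    sum (λ i → sum (λ k → sum (λ c → Z i (π i k ⟨$⟩ʳ c))))
      ≡⟨ sum-cong-≗ (λ i → ∑-comm (λ k c → Z i (π i k ⟨$⟩ʳ c))) ⟩
    sum (λ i → sum (λ c → sum (λ k → Z i (π i k ⟨$⟩ʳ c))))
      ≤⟨ sum-mono-≤ (λ i → sum-mono-≤ (disjoint i)) ⟩
    sum {suc n} (λ i → sum {M} (const 1))
      ∎)
  where
  open ≤-Reasoning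
  total : sum {M} (const 1) < sum (λ c → sum (λ i → Z i c))
  total = sum-mono-< cover c doublyCovered

-- Indicator functions.

indicator : ∀ {p} {P : Set p} → Dec P → ℕ
indicator (yes _) = 1
indicator (no  _) = 0

indicator-yes : ∀ {p} {P : Set p} (P? : Dec P) → P → indicator P? ≡ 1
indicator-yes (yes _) _ = refl
indicator-yes (no ¬p) p = contradiction p ¬p

indicator-no : ∀ {p} {P : Set p} (P? : Dec P) → ¬ P → indicator P? ≡ 0
indicator-no (yes p) ¬p = contradiction p ¬p
indicator-no (no _)  _  = refl

indicator-≥1 : ∀ {p} {P : Set p} (P? : Dec P) → P → 1 ≤ indicator P?
indicator-≥1 P? p = subst (1 ≤_) (sym (indicator-yes P? p)) ≤-refl

sum-indicator-≤1 : ∀ {p n} {P : Fin n → Set p} (P? : ∀ k → Dec (P k)) →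
                   (∀ {k l} → P k → P l → k ≡ l) → sum (indicator ∘ P?) ≤ 1
sum-indicator-≤1 {n = zero}  P? unique = z≤n
sum-indicator-≤1 {n = suc n} P? unique with P? zero
... | yes p₀ = subst (λ s → suc s ≤ 1)
                 (sym (sum-zero (λ k → indicator-no (P? (suc k)) (λ pk → 0≢1+n (unique p₀ pk)))))
                 ≤-refl
... | no  _  = sum-indicator-≤1 (P? ∘ suc) (λ pk pl → suc-injective (unique pk pl))

module _ {N : ℕ} .{{_ : NonZero N}} where

  -- Arithmetic modulo N.

  infix 4 _≈_
  _≈_ : ℕ → ℕ → Set
  a ≈ b = a % N ≡ b % N

  +-cong-≈ : ∀ {a b c d} → a ≈ b → c ≈ d → a + c ≈ b + d
  +-cong-≈ {a} {b} {c} {d} a≈b c≈d =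
    trans (%-distribˡ-+ a c N) (trans (cong₂ (λ x y → (x + y) % N) a≈b c≈d) (sym (%-distribˡ-+ b d N)))

  *-cong-≈ : ∀ {a b c d} → a ≈ b → c ≈ d → a * c ≈ b * d
  *-cong-≈ {a} {b} {c} {d} a≈b c≈d =
    trans (%-distribˡ-* a c N) (trans (cong₂ (λ x y → (x * y) % N) a≈b c≈d) (sym (%-distribˡ-* b d N)))

  toℕ-mod : ∀ a → toℕ (a mod N) ≡ a % N
  toℕ-mod a = toℕ-fromℕ< (m%n<n a N)

  toℕ-mod-≈ : ∀ a → toℕ (a mod N) ≈ a
  toℕ-mod-≈ a = trans (cong (_% N) (toℕ-mod a)) (m%n%n≡m%n a N)

  0%N≡0 : 0 % N ≡ 0
  0%N≡0 = m*n%n≡0 0 N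

  toℕ-0ₘ%N≡0 : toℕ (0ₘ {N}) % N ≡ 0
  toℕ-0ₘ%N≡0 = trans (toℕ-mod-≈ 0) 0%N≡0

  ≈⇒≡ : {x y : ℤmod N} → toℕ x ≈ toℕ y → x ≡ y
  ≈⇒≡ {x} {y} x≈y = toℕ-injective
    (trans (sym (m<n⇒m%n≡m (toℕ<n x))) (trans x≈y (m<n⇒m%n≡m (toℕ<n y))))

  -- pred N stands for −1.
  a+[N-1]b+b≈a : ∀ a b → a + pred N * b + b ≈ a
  a+[N-1]b+b≈a a b = trans (cong (_% N) (trans (lemma a b (pred N)) (cong (λ n → a + b * n) (suc-pred N))))
                           ([m+kn]%n≡m%n a b N)
    where
    lemma : ∀ a b n → a + n * b + b ≡ a + b * suc n
    lemma = solve-∀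

  a+b+[N-1]b≈a : ∀ a b → a + b + pred N * b ≈ a
  a+b+[N-1]b≈a a b = trans (cong (_% N) (lemma a b (pred N * b))) (a+[N-1]b+b≈a a b)
    where
    lemma : ∀ a b c → a + b + c ≡ a + c + b
    lemma = solve-∀

  -- Coefficient vectors and their translations.

  funToFin-cong : ∀ {m} {f g : Fin m → Fin N} → f ≗ g → funToFin f ≡ funToFin g
  funToFin-cong {zero}  f≗g = refl
  funToFin-cong {suc m} f≗g = cong₂ combine (f≗g zero) (funToFin-cong (f≗g ∘ suc))

  -- Vectors in ℤ_N^m are coded by `Fin (N ^ m)`, so that finite sums and permutations apply to
  -- them. The length is explicit since it cannot be inferred from `N ^ m`.
  coefficients : ∀ m → Fin (N ^ m) → Fin m → ℤmod N
  coefficients _ = finToFun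

  shift : ∀ {m} → (Fin m → ℕ) → Fin (N ^ m) → Fin (N ^ m)
  shift {m} t c = funToFin (λ j → (toℕ (coefficients m c j) + t j) mod N)

  coefficients-shift : ∀ {m : ℕ} (t : Fin m → ℕ) c j →
                       toℕ (coefficients m (shift t c) j) ≈ toℕ (coefficients m c j) + t j
  coefficients-shift {m} t c j =
    trans (cong (λ x → toℕ x % N) (finToFun-funToFin (λ j → (toℕ (coefficients m c j) + t j) mod N) j))
          (toℕ-mod-≈ _)

  coefficients-injective : ∀ m {c d : Fin (N ^ m)} →
                           (∀ j → toℕ (coefficients m c j) ≈ toℕ (coefficients m d j)) → c ≡ d
  coefficients-injective m {c} {d} c≈d =
    trans (sym (funToFin-finToFin {m} c))
      (trans (funToFin-cong (λ j → ≈⇒≡ (c≈d j))) (funToFin-finToFin {m} d))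

  -- Packaged as a permutation because `¬cover` reindexes a sum over all coefficient vectors along
  -- it.
  translation : ∀ {m} → (Fin m → ℕ) → Permutation′ (N ^ m)
  translation {m} t = permutation (shift t) (shift -t)
    (λ c → coefficients-injective m (λ j →
      trans (coefficients-shift t _ j)
        (trans (+-cong-≈ (coefficients-shift -t c j) refl) (a+[N-1]b+b≈a _ (t j)))))
    (λ c → coefficients-injective m (λ j →
      trans (coefficients-shift -t _ j)
        (trans (+-cong-≈ (coefficients-shift t c j) refl) (a+b+[N-1]b≈a _ (t j)))))
    where
    -t : Fin m → ℕ
    -t j = pred N * t j

  -- Linear forms and Bézout coefficients.

  infix 8 _∙_
  -- Values stay unreduced in ℕ: additivity and homogeneity are then true equalities, and N enters
  -- only through `≈`.
  _∙_ : ∀ {m} → (Fin m → ℕ) → Vec (ℤmod N) m → ℕ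
  t ∙ v = sum (λ j → t j * toℕ (lookup v j))

  ∙-cong-≈ : ∀ {m} {s t : Fin m → ℕ} → (∀ j → s j ≈ t j) → ∀ v → s ∙ v ≈ t ∙ v
  ∙-cong-≈ s≈t []      = refl
  ∙-cong-≈ s≈t (x ∷ v) = +-cong-≈ (*-cong-≈ (s≈t zero) refl) (∙-cong-≈ (s≈t ∘ suc) v)

  ∙-distrib-+ : ∀ {m} (s t : Fin m → ℕ) v → (λ j → s j + t j) ∙ v ≡ s ∙ v + t ∙ v
  ∙-distrib-+ s t []      = refl
  ∙-distrib-+ s t (x ∷ v) =
    trans (cong ((s zero + t zero) * toℕ x +_) (∙-distrib-+ (s ∘ suc) (t ∘ suc) v))
          (lemma (s zero) (t zero) (toℕ x) ((s ∘ suc) ∙ v) ((t ∘ suc) ∙ v))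
    where
    lemma : ∀ a b x p q → (a + b) * x + (p + q) ≡ a * x + p + (b * x + q)
    lemma = solve-∀

  ∙-homo-* : ∀ {m} k (t : Fin m → ℕ) v → (λ j → k * t j) ∙ v ≡ k * t ∙ v
  ∙-homo-* k t []      = sym (*-zeroʳ k)
  ∙-homo-* k t (x ∷ v) =
    trans (cong (k * t zero * toℕ x +_) (∙-homo-* k (t ∘ suc) v))
          (lemma k (t zero) (toℕ x) ((t ∘ suc) ∙ v))
    where
    lemma : ∀ k a x p → k * a * x + k * p ≡ k * (a * x + p)
    lemma = solve-∀

  -- Over ℕ the identity has two forms, according to which coefficient is negative; multiplying that
  -- one by `pred N` turns both into one congruence.
  bézout : ∀ a b → ∃[ s ] ∃[ r ] s * a + r * b ≈ gcd a b
  bézout a b with Bézout.identity (gcd-GCD a b)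
  ... | Bézout.+- s r eq = s , pred N * r ,
    trans (cong (λ x → (x + pred N * r * b) % N) (sym eq))
      (trans (cong (λ x → (gcd a b + r * b + x) % N) (lemma (pred N) r b)) (a+b+[N-1]b≈a (gcd a b) (r * b)))
    where
    lemma : ∀ n r b → n * r * b ≡ n * (r * b)
    lemma = solve-∀
  ... | Bézout.-+ s r eq = pred N * s , r ,
    trans (cong (λ x → (pred N * s * a + x) % N) (sym eq))
      (trans (cong (_% N) (lemma (pred N) s a (gcd a b))) (a+b+[N-1]b≈a (gcd a b) (s * a)))
    where
    lemma : ∀ n s a d → n * s * a + (d + s * a) ≡ d + s * a + n * (s * a)
    lemma = solve-∀

  -- Bézout for the head and the gcd of the tail, with the tail's coefficients scaled by `r`. The
  -- result is the direction t in which the translates are taken.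
  gcdWithModulus-attained : ∀ {m} (v : Vec (ℤmod N) m) → ∃[ t ] t ∙ v ≈ gcdWithModulus v
  -- The gcd of no entries is N, congruent to the empty sum 0.
  gcdWithModulus-attained []      = (λ ()) , trans 0%N≡0 (sym (n%n≡0 N))
  gcdWithModulus-attained (x ∷ v) =
    let t , t∙v≈d = gcdWithModulus-attained v
        s , r , eq = bézout (toℕ x) (gcdWithModulus v)
    in (λ { zero → s ; (suc j) → r * t j }) ,
       trans (+-cong-≈ {s * toℕ x} refl
               (trans (cong (_% N) (∙-homo-* r t v)) (*-cong-≈ {r} refl t∙v≈d)))
             eq

  gcdWithModulus-∣-modulus : ∀ {m} (v : Vec (ℤmod N) m) → gcdWithModulus v ∣ N
  gcdWithModulus-∣-modulus []      = ∣-refl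
  gcdWithModulus-∣-modulus (x ∷ v) = ∣-trans (gcd[m,n]∣n (toℕ x) _) (gcdWithModulus-∣-modulus v)

  gcdWithModulus-∣-lookup : ∀ {m} (v : Vec (ℤmod N) m) j → gcdWithModulus v ∣ toℕ (lookup v j)
  gcdWithModulus-∣-lookup (x ∷ v) zero    = gcd[m,n]∣m (toℕ x) _
  gcdWithModulus-∣-lookup (x ∷ v) (suc j) = ∣-trans (gcd[m,n]∣n (toℕ x) _) (gcdWithModulus-∣-lookup v j)

  -- Rules out α = 1: a gcd equal to N would divide every representative in the column, making all
  -- of them 0.
  columnGcd≢modulus : ∀ {m n} (g : Matrix N m n) → NoZeroColumn g → ∀ i → columnGcd g i ≢ N
  columnGcd≢modulus g nonzero i d≡N with nonzero i
  ... | j , x≢0 = x≢0 (≈⇒≡ (trans (n∣m⇒m%n≡0 _ N N∣x) (sym toℕ-0ₘ%N≡0)))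
    where
    N∣x : N ∣ toℕ (lookup (lookup g j) i)
    N∣x = subst (_∣ toℕ (lookup (lookup g j) i)) d≡N
            (subst (λ x → columnGcd g i ∣ toℕ x) (lookup-map j (λ row → lookup row i) g)
              (gcdWithModulus-∣-lookup (column g i) j))

  lookup-linearCombination : ∀ {m n} (c : Vec (ℤmod N) m) (g : Matrix N m n) i →
    toℕ (lookup (linearCombination c g) i) ≈ (toℕ ∘ lookup c) ∙ column g i
  lookup-linearCombination []      []        i =
    trans (cong (λ x → toℕ x % N) (lookup-replicate i 0ₘ)) (toℕ-mod-≈ 0)
  lookup-linearCombination (x ∷ c) (row ∷ g) i =
    trans (cong (λ y → toℕ y % N) (lookup-zipWith _+ₘ_ i (x *ᵥ row) (linearCombination c g)))
      (trans (toℕ-mod-≈ _)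
        (+-cong-≈ (trans (cong (λ y → toℕ y % N) (lookup-map i (x *ₘ_) row)) (toℕ-mod-≈ _))
                  (lookup-linearCombination c g i)))

  -- The subgroups Kᵢ and their translates.

  -- Otherwise N divides the difference (l - k)d, which is positive and less than n d ≤ N.
  multiple-unique-< : ∀ {n d y k l} .{{_ : NonZero d}} → d * n ≤ N → l < n → k < l →
                      N ∣ y + k * d → ¬ (N ∣ y + l * d)
  multiple-unique-< {n} {d} {y} {k} {l} dn≤N l<n k<l N∣k N∣l =
    >⇒∤ {{>-nonZero 0<e*d}} e*d<N (∣m+n∣m⇒∣n (subst (N ∣_) eq N∣l) N∣k)
    where
    e : ℕ
    e = l ∸ k
    0<e*d : 0 < e * d
    0<e*d = *-monoˡ-< d (m<n⇒0<n∸m k<l)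
    e*d<N : e * d < N
    e*d<N = <-≤-trans (*-monoˡ-< d (≤-<-trans (m∸n≤m l k) l<n)) (subst (_≤ N) (*-comm d n) dn≤N)
    lemma : ∀ y k e d → y + (k + e) * d ≡ y + k * d + e * d
    lemma = solve-∀
    eq : y + l * d ≡ y + k * d + e * d
    eq = trans (cong (λ l → y + l * d) (sym (m+[n∸m]≡n (<⇒≤ k<l)))) (lemma y k e d)

  multiple-unique : ∀ {n d y} .{{_ : NonZero d}} → d * n ≤ N → {k l : Fin n} →
                    N ∣ y + toℕ k * d → N ∣ y + toℕ l * d → k ≡ l
  multiple-unique {y = y} dn≤N {k} {l} N∣k N∣l with <-cmp (toℕ k) (toℕ l)
  ... | tri< k<l _ _ = contradiction N∣l (multiple-unique-< {y = y} dn≤N (toℕ<n l) k<l N∣k)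
  ... | tri≈ _ k≡l _ = toℕ-injective k≡l
  ... | tri> _ _ l<k = contradiction N∣k (multiple-unique-< {y = y} dn≤N (toℕ<n k) l<k N∣l)

  module _ {m n : ℕ} (g : Matrix N m n) where

    entry : Fin n → Fin (N ^ m) → ℕ
    entry i c = (toℕ ∘ coefficients m c) ∙ column g i

    -- Decides membership of `c` in the subgroup Kᵢ.
    vanishes? : ∀ i c → Dec (entry i c % N ≡ 0)
    vanishes? i c = entry i c % N ≟ 0

    entry-translation : ∀ i t c → entry i (translation t ⟨$⟩ʳ c) ≈ entry i c + t ∙ column g i
    entry-translation i t c =
      trans (∙-cong-≈ (coefficients-shift t c) (column g i))
            (cong (_% N) (∙-distrib-+ (toℕ ∘ coefficients m c) t (column g i)))

    columnGcd-nonZero : ∀ i → NonZero (columnGcd g i)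
    columnGcd-nonZero i = ≢-nonZero λ d≡0 →
      ≢-nonZero⁻¹ N (0∣⇒≡0 (subst (_∣ N) d≡0 (gcdWithModulus-∣-modulus (column g i))))

    zeroCombination : Fin (N ^ m)
    zeroCombination = funToFin {m} (λ _ → 0ₘ)

    zeroCombination-vanishes : ∀ i → entry i zeroCombination % N ≡ 0
    zeroCombination-vanishes i =
      trans (∙-cong-≈ {t = const 0}
              (λ j → trans (cong (λ x → toℕ x % N) (finToFun-funToFin {m} (λ _ → 0ₘ) j)) (toℕ-mod-≈ 0))
              (column g i))
            (trans (cong (_% N) (sum-zero {f = λ j → 0 * toℕ (lookup (column g i) j)} (λ _ → refl))) 0%N≡0)

    -- `large` says that every index N / gcdᵢ is at least n, written without division; for a thin
    -- code it will be refuted.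
    module _ (large : ∀ i → columnGcd g i * n ≤ N) where

      t : Fin n → Fin m → ℕ
      t i = proj₁ (gcdWithModulus-attained (column g i))

      t-attains : ∀ i → t i ∙ column g i ≈ columnGcd g i
      t-attains i = proj₂ (gcdWithModulus-attained (column g i))

      step : Fin n → Fin n → Permutation′ (N ^ m)
      step i k = translation (λ j → toℕ k * t i j)

      entry-step : ∀ i k c → entry i (step i k ⟨$⟩ʳ c) ≈ entry i c + toℕ k * columnGcd g i
      entry-step i k c =
        trans (entry-translation i _ c)
          (+-cong-≈ {entry i c} refl
            (trans (cong (_% N) (∙-homo-* (toℕ k) (t i) (column g i))) (*-cong-≈ {toℕ k} refl (t-attains i))))

      -- The k-th summand is 1 exactly when c lies in Kᵢ - k tᵢ, that is, when N divides entry + k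
      -- gcdᵢ; this happens for at most one k below n.
      translates-disjoint : ∀ i c → sum (λ k → indicator (vanishes? i (step i k ⟨$⟩ʳ c))) ≤ 1
      translates-disjoint i c = sum-indicator-≤1 (λ k → vanishes? i (step i k ⟨$⟩ʳ c))
        (λ {k} {l} p q → multiple-unique {y = entry i c} {{columnGcd-nonZero i}} (large i)
                            (divisible k p) (divisible l q))
        where
        divisible : ∀ k → entry i (step i k ⟨$⟩ʳ c) % N ≡ 0 → N ∣ entry i c + toℕ k * columnGcd g i
        divisible k p = m%n≡0⇒n∣m _ N (trans (sym (entry-step i k c)) p)

-- From thinness to a large column gcd.

-- Thinness makes the Kᵢ cover all coefficient vectors. The length is at least 2 so that the zero
-- vector is covered twice, which gives the strict inequality in the count.
thin⇒largeColumnGcd : ∀ {ℓ N m n} .{{_ : NonZero N}} (C : LinearCode N (suc (suc n)) ℓ)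
  (g : Matrix N m (suc (suc n))) → Generates g C → Thin C →
  ∃[ i ] N < columnGcd g i * suc (suc n)
thin⇒largeColumnGcd {N = N} {m} {n} C g generates thin =
  case ¬∀⟶∃¬ _ (λ i → columnGcd g i * suc (suc n) ≤ N) (λ i → _ ≤? _) impossible of λ where
    (i , ≰N) → i , ≰⇒> ≰N
  where
  Z : Fin (suc (suc n)) → Fin (N ^ m) → ℕ
  Z i c = indicator (vanishes? g i c)

  word : Fin (N ^ m) → Vec (ℤmod N) (suc (suc n))
  word c = linearCombination (tabulate (coefficients m c)) g

  word-entry : ∀ c i → lookup (word c) i ≡ 0ₘ → entry g i c % N ≡ 0
  word-entry c i eq =
    trans (∙-cong-≈ (λ j → cong (λ x → toℕ x % N) (sym (lookup∘tabulate (coefficients m c) j))) (column g i))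
      (trans (sym (lookup-linearCombination (tabulate (coefficients m c)) g i))
        (trans (cong (λ x → toℕ x % N) eq) toℕ-0ₘ%N≡0))

  cover : ∀ c → 1 ≤ sum (λ i → Z i c)
  cover c with 1 ≤? sum (λ i → Z i c)
  ... | yes 1≤Z = 1≤Z
  -- A vector in no Kᵢ yields a word without zero entries.
  ... | no  1≰Z = contradiction
    (word c , Equivalence.from (generates (word c)) (tabulate (coefficients m c) , refl) ,
     lookup⁻ (λ i eq → 1≰Z (≤-trans (indicator-≥1 (vanishes? g i c) (word-entry c i eq))
                                  (term≤sum (λ i → Z i c) i))))
    thin

  doublyCovered : 1 < sum (λ i → Z i (zeroCombination g))
  doublyCovered =
    -- The first two coordinates already count the zero vector twice.
    +-mono-≤ (at zero) (≤-trans (at (suc zero)) (term≤sum (λ i → Z (suc i) (zeroCombination g)) zero))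
    where
    at : ∀ i → 1 ≤ Z i (zeroCombination g)
    at i = indicator-≥1 (vanishes? g i _) (zeroCombination-vanishes g i)

  impossible : ¬ (∀ i → columnGcd g i * suc (suc n) ≤ N)
  impossible large =
    ¬cover Z (step g large) (translates-disjoint g large) cover (zeroCombination g) doublyCovered

-- The possible values of α.

-- Cancelling d in d α = N < 5 d leaves α < 5; α = 0 would force N = 0, and α = 1 would force d = N.
cofactor : ∀ {d N} .{{_ : NonZero N}} → d ∣ N → N < d * 5 → d ≢ N →
           ∃[ α ] (α ≡ 2 ⊎ α ≡ 3 ⊎ α ≡ 4) × d * α ≡ N
cofactor {d} {N} (divides α N≡αd) N<5d d≢N = α , small α α<5 dα≡N , dα≡N
  where
  dα≡N : d * α ≡ N
  dα≡N = trans (*-comm d α) (sym N≡αd)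

  α<5 : α < 5
  α<5 = *-cancelˡ-< d α 5 (subst (_< d * 5) (sym dα≡N) N<5d)

  small : ∀ α → α < 5 → d * α ≡ N → α ≡ 2 ⊎ α ≡ 3 ⊎ α ≡ 4
  small 0 _ eq = contradiction (trans (sym eq) (*-zeroʳ d)) (≢-nonZero⁻¹ N)
  small 1 _ eq = contradiction (trans (sym (*-identityʳ d)) eq) d≢N
  small 2 _ _  = inj₁ refl
  small 3 _ _  = inj₂ (inj₁ refl)
  small 4 _ _  = inj₂ (inj₂ refl)
  small (suc (suc (suc (suc (suc _))))) (s≤s (s≤s (s≤s (s≤s (s≤s ()))))) _

lemma3p1 : ∀ {ℓ : Level} (N : ℕ) .{{_ : NonZero N}} (m : ℕ)
    (C : LinearCode N 5 ℓ) (g : Matrix N m 5) →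
    Extended C →
    Generates g C →
    entriesGcd g ≡ 1 →
    NoZeroColumn g →
    Thin C →
    ∃[ i ] ∃[ α ] (α ≡ 2 ⊎ α ≡ 3 ⊎ α ≡ 4) × columnGcd g i * α ≡ N
lemma3p1 N m C g _ generates _ nonzero thin =
  -- Length 5 is the case n = 3 of `suc (suc n)`.
  let i , N<5d = thin⇒largeColumnGcd C g generates thin
      d∣N = gcdWithModulus-∣-modulus (column g i)
  in i , cofactor d∣N N<5d (columnGcd≢modulus g nonzero i)
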